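{- Let $Q_0=sat(u,l)$, where $u$ is a representation of a propositional formula in CNF and $l$ is the list of the variables in $u$. Then the occur-check is unnecessary for $P_3$ and $Q_0$ under any selection rule: for each SLD-derivation for $P_3$ starting from $Q_0$ (via any selection rule), whenever an atom $A$ selected in a query of the derivation is to be unified with the head $H$ of a (renamed apart) rule of $P_3$ with the same predicate symbol as $A$, the equation $A=H$ is NSTO (not subject to occur-check).
   Context: Prolog list notation is used ($[\,]$ is a constant, $[h|t]$ a binary constructor); $-$ is a binary function symbol written infix; $\mathtt{true},\mathtt{false}$ are constants. Representation of CNF formulae: propositional variables are represented as logical variables; a positive literal $x$ is represented as the term $\mathtt{true}-X$, a negative literal $\neg x$ as $\mathtt{false}-X$; a clause is represented as the list of the representations of its literals, and a conjunction of clauses as the list of the representations of the clauses. A set of equations $E$ is NSTO (not subject to occur-check) if in no execution of the (nondeterministic) Martelli–Montanari unification algorithm started with $E$ does one reach a set containing an equation $x=t$ with $x$ a variable, $t\neq x$ and $x$ occurring in $t$ (the situation in which the algorithm would halt with failure due to the occur-check). For atoms $A=p(a_1,\ldots,a_n)$ and $H=p(h_1,\ldots,h_n)$, the equation $A=H$ stands for the set $\{a_1=h_1,\ldots,a_n=h_n\}$. The definite clause program $P_3$ consists of the following rules (names beginning with upper-case letters are variables): 1. $sat\_cnf([\,])$. 2. $sat\_cnf([C|Cs])\gets sat\_cl(C), sat\_cnf(Cs)$. 3. $sat\_cl([P-V|R])\gets sat\_cl3(R,V,P)$. 4. ${=}(X,X)$. 5. $sat\_cl3([\,],V,P)\gets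 V=P$. 6. $sat\_cl3([P_2-V_2|R],V_1,P_1)\gets sat\_cl5(V_1,P_1,V_2,P_2,R)$. 7. $sat\_cl5(V_1,P_1,V_2,P_2,R)\gets sat\_cl5a(V_1,P_1,V_2,P_2,R)$. 8. $sat\_cl5(V_1,P_1,V_2,P_2,R)\gets sat\_cl5a(V_2,P_2,V_1,P_1,R)$. 9. $sat\_cl5a(V_1,P_1,V_2,P_2,R)\gets V_1=P_1$. 10. $sat\_cl5a(V_1,P_1,V_2,P_2,R)\gets sat\_cl3(R,V_2,P_2)$. 11. $sat(Cs,Vs)\gets sat\_cnf(Cs), tflist(Vs)$. 12. $tflist([\,])$. 13. $tflist([V|Vs])\gets tflist(Vs), tf(V)$. 14. $tf(\mathtt{true})$. 15. $tf(\mathtt{false})$. -}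

module Defs where

open import Data.Nat using (ℕ; _≟_)
open import Data.List using (List; []; _∷_; _++_; map; foldr; concatMap)
open import Data.List.Membership.Propositional using (_∈_; _∉_)
open import Data.List.Relation.Binary.BagAndSetEquality using (_∼[_]_; set)
open import Data.List.Relation.Unary.All using (All)
open import Data.List.Relation.Unary.Unique.Propositional using (Unique)
open import Data.Product using (_×_; _,_; ∃; ∃-syntax)
open import Data.Sum using (_⊎_)
open import Data.Vec using (Vec; []; _∷_; toList; zipWith)
open import Function.Bundles using (_↔_; _⇔_; module Inverse)
open import Relation.Binary.Construct.Closure.ReflexiveTransitive using (Star)
open import Relation.Binary.PropositionalEquality using (_≡_; _≢_)
open import Relation.Nullary using (¬_; yes; no)

------------------------------------------------------------------------
-- Terms, atoms, clauses

Var : Set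
Var = ℕ

data Fun : ℕ → Set where
  nil true false : Fun 0
  cons minus     : Fun 2

data Pred : ℕ → Set where
  sat-cnf sat-cl tflist tf : Pred 1
  eq sat                   : Pred 2
  sat-cl3                  : Pred 3
  sat-cl5 sat-cl5a         : Pred 5

data Term : Set where
  var : Var → Term
  app : ∀ {n} → Fun n → Vec Term n → Term

data Atom : Set where
  atom : ∀ {n} → Pred n → Vec Term n → Atom

Query : Set
Query = List Atom

infix 4 _←_

record Clause : Set where
  constructor _←_
  field
    head : Atom
    body : Query

Program : Set
Program = List Clause

varsᵗ  : Term → List Var
varsᵗˢ : ∀ {n} → Vec Term n → List Var
varsᵗ (var x)    = x ∷ []
varsᵗ (app f ts) = varsᵗˢ ts
varsᵗˢ []       = []
varsᵗˢ (t ∷ ts) = varsᵗ t ++ varsᵗˢ ts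

varsᵃ : Atom → List Var
varsᵃ (atom p ts) = varsᵗˢ ts

varsᑫ : Query → List Var
varsᑫ = concatMap varsᵃ

varsᶜ : Clause → List Var
varsᶜ (H ← B) = varsᵃ H ++ varsᑫ B

applyᵗ  : (Var → Term) → Term → Term
applyᵗˢ : ∀ {n} → (Var → Term) → Vec Term n → Vec Term n
applyᵗ σ (var x)    = σ x
applyᵗ σ (app f ts) = app f (applyᵗˢ σ ts)
applyᵗˢ σ []       = []
applyᵗˢ σ (t ∷ ts) = applyᵗ σ t ∷ applyᵗˢ σ ts

applyᵃ : (Var → Term) → Atom → Atom
applyᵃ σ (atom p ts) = atom p (applyᵗˢ σ ts)

applyᑫ : (Var → Term) → Query → Query
applyᑫ σ = map (applyᵃ σ)

applyᶜ : (Var → Term) → Clause → Clause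
applyᶜ σ (H ← B) = applyᵃ σ H ← applyᑫ σ B

------------------------------------------------------------------------
-- Substitutions

-- `support` may be any finite list containing the domain { x | xθ ≢ x }.
record Subst : Set where
  field
    ⟦_⟧     : Var → Term
    support : List Var
    finite  : ∀ x → x ∉ support → ⟦_⟧ x ≡ var x

open Subst public using (⟦_⟧)

_∈Dom_ : Var → Subst → Set
x ∈Dom θ = ⟦ θ ⟧ x ≢ var x

_∈Vars_ : Var → Subst → Set
x ∈Vars θ = ∃[ y ] (y ∈Dom θ × (x ≡ y ⊎ x ∈ varsᵗ (⟦ θ ⟧ y)))

Unifies : Subst → Atom → Atom → Set
Unifies θ A H = applyᵃ ⟦ θ ⟧ A ≡ applyᵃ ⟦ θ ⟧ H

IsMgu : Subst → Atom → Atom → Set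
IsMgu θ A H = Unifies θ A H ×
  (∀ τ → Unifies τ A H → ∃[ η ] (∀ x → ⟦ τ ⟧ x ≡ applyᵗ ⟦ η ⟧ (⟦ θ ⟧ x)))

IsRenaming : Subst → Set
IsRenaming ρ = ∃ λ (π : Var ↔ Var) → ∀ x → ⟦ ρ ⟧ x ≡ var (Inverse.to π x)

_VariantOf_ : Clause → Clause → Set
c′ VariantOf c = ∃[ ρ ] (IsRenaming ρ × c′ ≡ applyᶜ ⟦ ρ ⟧ c)

------------------------------------------------------------------------
-- Martelli–Montanari algorithm

infix 6 _≐_ _≐*_

record Equation : Set where
  constructor _≐_
  field
    lhs rhs : Term

varsᵉ : Equation → List Var
varsᵉ (s ≐ t) = varsᵗ s ++ varsᵗ t

_≐*_ : ∀ {n} → Vec Term n → Vec Term n → List Equation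
ss ≐* ts = toList (zipWith _≐_ ss ts)

[_↦_] : Var → Term → Var → Term
[ x ↦ t ] y with y ≟ x
... | yes _ = t
... | no  _ = var y

applyᵉ : (Var → Term) → Equation → Equation
applyᵉ σ (s ≐ t) = applyᵗ σ s ≐ applyᵗ σ t

IsVar : Term → Set
IsVar t = ∃[ x ] t ≡ var x

infix 4 _∋_∖_

-- Lists stand for finite sets: `E ∋ e ∖ F` says that, as sets, e ∈ E and
-- F = E \ {e}.  In this way order and multiplicity play no role.
_∋_∖_ : List Equation → Equation → List Equation → Set
E ∋ e ∖ F = E ∼[ set ] (e ∷ F) × e ∉ F

infix 4 _⟶_

-- The two actions that halt with failure (clash of function symbols, and
-- occur-check) yield no new set, hence have no constructor.
data _⟶_ (E : List Equation) : List Equation → Set where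
  decompose : ∀ {n F} {f : Fun n} {ss ts : Vec Term n} →
              E ∋ app f ss ≐ app f ts ∖ F →
              E ⟶ (ss ≐* ts ++ F)
  delete    : ∀ {F x} →
              E ∋ var x ≐ var x ∖ F →
              E ⟶ F
  swap      : ∀ {F t x} →
              E ∋ t ≐ var x ∖ F →
              ¬ IsVar t →
              E ⟶ (var x ≐ t ∷ F)
  eliminate : ∀ {F x t} →
              E ∋ var x ≐ t ∖ F →
              t ≢ var x →
              x ∉ varsᵗ t →
              x ∈ concatMap varsᵉ F →
              E ⟶ (var x ≐ t ∷ map (applyᵉ [ x ↦ t ]) F)

OccurCheckFailure : List Equation → Set
OccurCheckFailure E =
  ∃[ x ] ∃[ t ] ((var x ≐ t) ∈ E × t ≢ var x × x ∈ varsᵗ t)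

NSTO : List Equation → Set
NSTO E = ∀ E′ → Star _⟶_ E E′ → ¬ OccurCheckFailure E′

------------------------------------------------------------------------
-- SLD-derivations

-- The clause variants and mgus used so far, latest first.
History : Set
History = List (Clause × Subst)

RenamedApart : Clause → Query → History → Set
RenamedApart c Q₀ h = ∀ x → x ∈ varsᶜ c →
  x ∉ varsᑫ Q₀ ×
  All (λ (c′ , θ) → x ∉ varsᶜ c′ × ¬ (x ∈Vars θ)) h

-- `SLD P Q₀ h Q`: some SLD-derivation for P starting from Q₀ reaches the
-- query Q with history h.  Any atom of a query may be the selected one, so
-- that derivations via all selection rules are covered.
data SLD (P : Program) (Q₀ : Query) : History → Query → Set where
  start : SLD P Q₀ [] Q₀
  step  : ∀ {h Q₁ A Q₂ c H B θ} →
          SLD P Q₀ h (Q₁ ++ A ∷ Q₂) →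
          c ∈ P →
          (H ← B) VariantOf c →
          RenamedApart (H ← B) Q₀ h →
          IsMgu θ A H →
          SLD P Q₀ (((H ← B) , θ) ∷ h) (applyᑫ ⟦ θ ⟧ (Q₁ ++ B ++ Q₂))

OccurCheckUnnecessary : Program → Query → Set
OccurCheckUnnecessary P Q₀ =
  ∀ {h Q} → SLD P Q₀ h Q →
  ∀ {n} {p : Pred n} {as : Vec Term n} → atom p as ∈ Q →
  ∀ {c hs B} → c ∈ P →
  (atom p hs ← B) VariantOf c →
  RenamedApart (atom p hs ← B) Q₀ h →
  NSTO (as ≐* hs)

------------------------------------------------------------------------
-- The program P₃

infixr 5 _∷ᵗ_
infix  6 _−_

pattern []ᵗ      = app nil []
pattern _∷ᵗ_ h t = app cons (h ∷ t ∷ [])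
pattern _−_ s t  = app minus (s ∷ t ∷ [])
pattern trueᵗ    = app true []
pattern falseᵗ   = app false []

P₃ : Program
P₃ =
    (atom sat-cnf ([]ᵗ ∷ []) ← [])
  ∷ (atom sat-cnf ((C ∷ᵗ Cs) ∷ []) ←
       atom sat-cl (C ∷ []) ∷ atom sat-cnf (Cs ∷ []) ∷ [])
  ∷ (atom sat-cl ((P − V ∷ᵗ R) ∷ []) ← atom sat-cl3 (R ∷ V ∷ P ∷ []) ∷ [])
  ∷ (atom eq (X ∷ X ∷ []) ← [])
  ∷ (atom sat-cl3 ([]ᵗ ∷ V ∷ P ∷ []) ← atom eq (V ∷ P ∷ []) ∷ [])
  ∷ (atom sat-cl3 ((P₂ − V₂ ∷ᵗ R) ∷ V₁ ∷ P₁ ∷ []) ←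
       atom sat-cl5 (V₁ ∷ P₁ ∷ V₂ ∷ P₂ ∷ R ∷ []) ∷ [])
  ∷ (atom sat-cl5 (V₁ ∷ P₁ ∷ V₂ ∷ P₂ ∷ R ∷ []) ←
       atom sat-cl5a (V₁ ∷ P₁ ∷ V₂ ∷ P₂ ∷ R ∷ []) ∷ [])
  ∷ (atom sat-cl5 (V₁ ∷ P₁ ∷ V₂ ∷ P₂ ∷ R ∷ []) ←
       atom sat-cl5a (V₂ ∷ P₂ ∷ V₁ ∷ P₁ ∷ R ∷ []) ∷ [])
  ∷ (atom sat-cl5a (V₁ ∷ P₁ ∷ V₂ ∷ P₂ ∷ R ∷ []) ←
       atom eq (V₁ ∷ P₁ ∷ []) ∷ [])
  ∷ (atom sat-cl5a (V₁ ∷ P₁ ∷ V₂ ∷ P₂ ∷ R ∷ []) ←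
       atom sat-cl3 (R ∷ V₂ ∷ P₂ ∷ []) ∷ [])
  ∷ (atom sat (Cs ∷ Vs ∷ []) ←
       atom sat-cnf (Cs ∷ []) ∷ atom tflist (Vs ∷ []) ∷ [])
  ∷ (atom tflist ([]ᵗ ∷ []) ← [])
  ∷ (atom tflist ((V ∷ᵗ Vs) ∷ []) ←
       atom tflist (Vs ∷ []) ∷ atom tf (V ∷ []) ∷ [])
  ∷ (atom tf (trueᵗ ∷ []) ← [])
  ∷ (atom tf (falseᵗ ∷ []) ← [])
  ∷ []
  where
  C Cs P V R X P₁ V₁ P₂ V₂ Vs : Term
  C  = var 0
  Cs = var 1
  P  = var 2
  V  = var 3
  R  = var 4
  X  = var 5
  P₁ = var 6
  V₁ = var 7
  P₂ = var 8
  V₂ = var 9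
  Vs = var 10

------------------------------------------------------------------------
-- CNF formulae and their representation

PropVar : Set
PropVar = ℕ

data Literal : Set where
  pos neg : PropVar → Literal

CNF : Set
CNF = List (List Literal)

listᵗ : List Term → Term
listᵗ = foldr _∷ᵗ_ []ᵗ

-- ν assigns to each propositional variable the logical variable
-- representing it.
module _ (ν : PropVar → Var) where

  repLiteral : Literal → Term
  repLiteral (pos x) = trueᵗ − var (ν x)
  repLiteral (neg x) = falseᵗ − var (ν x)

  repCNF : CNF → Term
  repCNF φ = listᵗ (map (λ cl → listᵗ (map repLiteral cl)) φ)

-- The order of the variables is left open.
IsListOfVars : List Var → Term → Set
IsListOfVars xs u = Unique xs × (∀ x → x ∈ xs ⇔ x ∈ varsᵗ u)

{-# OPTIONS --safe #-}

-- Every query of a derivation is well typed: its arguments are nested lists of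
-- pairs P − V with P a truth value and V a variable or a truth value.  An mgu
-- of a well-typed atom with a clause head sends the variables outside the head
-- to variables or truth values, because some unifier does; this preserves
-- well-typedness.
--
-- For NSTO, interpret terms in the free algebra with one operation of each
-- arity.  If some valuation there makes the two sides of each equation equal
-- unless their root symbols differ, then the same holds after any
-- Martelli–Montanari step, and it excludes x = t with x properly inside t.
-- A well-typed atom and a clause head always have such a valuation.

module Submission where

open import Defs
open import Data.Empty using (⊥-elim)
open import Data.List using (List; []; _∷_; _++_; map)
open import Data.List.Membership.Propositional using (_∈_; _∉_; lose; find)
open import Data.List.Membership.Propositional.Properties
  using (∈-++⁺ˡ; ∈-++⁺ʳ; ∈-++⁻; ∈-map⁻; ∈-concatMap⁺; ∈-concatMap⁻)
open import Data.List.Relation.Unary.All as All using (All; []; _∷_)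
import Data.List.Relation.Unary.All.Properties as All
open import Data.List.Relation.Unary.Any using (here; there)
open import Data.Nat using (ℕ; suc; _+_; _≤_; _<_; s≤s; _≟_)
open import Data.List.Membership.DecPropositional _≟_ using (_∈?_)
open import Data.Nat.Properties
  using (≤-refl; ≤-trans; <⇒≤; m≤m+n; m≤n+m; n≮n)
open import Data.Product using (_×_; _,_; ∃; ∃-syntax; proj₁; proj₂)
open import Data.Sum using (_⊎_; inj₁; inj₂)
import Data.Sum as Sum
open import Data.Vec using (Vec; []; _∷_)
open import Data.Vec.Properties using (∷-injectiveˡ; ∷-injectiveʳ)
open import Data.Vec.Relation.Binary.Pointwise.Inductive as Pointwise using (Pointwise; []; _∷_)
open import Function using (_∘_)
open import Function.Bundles using (_↔_; module Inverse; module Equivalence)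
open import Function.Definitions using (Injective)
open import Relation.Binary.Construct.Closure.ReflexiveTransitive using (ε; _◅_)
open import Relation.Binary.PropositionalEquality
  using (_≡_; _≢_; refl; sym; trans; cong; cong₂; subst)
open import Relation.Nullary using (yes; no)

private
  variable
    m n : ℕ
    x : Var
    s t : Term
    σ τ : Var → Term

-- Variables and substitutions

applyᵗ-∘  : ∀ t → applyᵗ σ (applyᵗ τ t) ≡ applyᵗ (applyᵗ σ ∘ τ) t
applyᵗˢ-∘ : (ts : Vec Term n) → applyᵗˢ σ (applyᵗˢ τ ts) ≡ applyᵗˢ (applyᵗ σ ∘ τ) ts
applyᵗ-∘ (var x)    = refl
applyᵗ-∘ (app f ts) = cong (app f) (applyᵗˢ-∘ ts)
applyᵗˢ-∘ []       = refl
applyᵗˢ-∘ (t ∷ ts) = cong₂ _∷_ (applyᵗ-∘ t) (applyᵗˢ-∘ ts)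

applyᵃ-∘ : ∀ A → applyᵃ σ (applyᵃ τ A) ≡ applyᵃ (applyᵗ σ ∘ τ) A
applyᵃ-∘ (atom p ts) = cong (atom p) (applyᵗˢ-∘ ts)

applyᑫ-∘ : ∀ Q → applyᑫ σ (applyᑫ τ Q) ≡ applyᑫ (applyᵗ σ ∘ τ) Q
applyᑫ-∘ []      = refl
applyᑫ-∘ (A ∷ Q) = cong₂ _∷_ (applyᵃ-∘ A) (applyᑫ-∘ Q)

applyᵗ-cong  : ∀ t → (∀ {x} → x ∈ varsᵗ t → σ x ≡ τ x) → applyᵗ σ t ≡ applyᵗ τ t
applyᵗˢ-cong : (ts : Vec Term n) → (∀ {x} → x ∈ varsᵗˢ ts → σ x ≡ τ x) →
               applyᵗˢ σ ts ≡ applyᵗˢ τ ts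
applyᵗ-cong (var x)    h = h (here refl)
applyᵗ-cong (app f ts) h = cong (app f) (applyᵗˢ-cong ts h)
applyᵗˢ-cong []       h = refl
applyᵗˢ-cong (t ∷ ts) h =
  cong₂ _∷_ (applyᵗ-cong t (h ∘ ∈-++⁺ˡ)) (applyᵗˢ-cong ts (h ∘ ∈-++⁺ʳ (varsᵗ t)))

vars-applyᵗ⁺  : ∀ t {y} → y ∈ varsᵗ t → x ∈ varsᵗ (σ y) → x ∈ varsᵗ (applyᵗ σ t)
vars-applyᵗˢ⁺ : ∀ (ts : Vec Term n) {y} → y ∈ varsᵗˢ ts → x ∈ varsᵗ (σ y) →
                x ∈ varsᵗˢ (applyᵗˢ σ ts)
vars-applyᵗ⁺ (var _) (here refl) x∈ = x∈
vars-applyᵗ⁺ (app f ts) y∈ x∈ = vars-applyᵗˢ⁺ ts y∈ x∈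
vars-applyᵗˢ⁺ {σ = σ} (t ∷ ts) y∈ x∈ with ∈-++⁻ (varsᵗ t) y∈
... | inj₁ y∈t  = ∈-++⁺ˡ (vars-applyᵗ⁺ t y∈t x∈)
... | inj₂ y∈ts = ∈-++⁺ʳ (varsᵗ (applyᵗ σ t)) (vars-applyᵗˢ⁺ ts y∈ts x∈)

vars-applyᵗ⁻  : ∀ t → x ∈ varsᵗ (applyᵗ σ t) → ∃[ y ] (y ∈ varsᵗ t × x ∈ varsᵗ (σ y))
vars-applyᵗˢ⁻ : (ts : Vec Term n) → x ∈ varsᵗˢ (applyᵗˢ σ ts) →
                ∃[ y ] (y ∈ varsᵗˢ ts × x ∈ varsᵗ (σ y))
vars-applyᵗ⁻ (var y)    x∈ = y , here refl , x∈
vars-applyᵗ⁻ (app f ts) x∈ = vars-applyᵗˢ⁻ ts x∈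
vars-applyᵗˢ⁻ {σ = σ} (t ∷ ts) x∈ with ∈-++⁻ (varsᵗ (applyᵗ σ t)) x∈
... | inj₁ x∈t  = let y , y∈ , x∈σy = vars-applyᵗ⁻ t x∈t in y , ∈-++⁺ˡ y∈ , x∈σy
... | inj₂ x∈ts = let y , y∈ , x∈σy = vars-applyᵗˢ⁻ ts x∈ts
                  in y , ∈-++⁺ʳ (varsᵗ t) y∈ , x∈σy

-- Variables of queries along a derivation

∈-varsᑫ⁺ : ∀ {A Q} → A ∈ Q → x ∈ varsᵃ A → x ∈ varsᑫ Q
∈-varsᑫ⁺ A∈Q x∈A = ∈-concatMap⁺ varsᵃ (lose A∈Q x∈A)

∈-varsᑫ⁻ : ∀ Q → x ∈ varsᑫ Q → ∃[ A ] (A ∈ Q × x ∈ varsᵃ A)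
∈-varsᑫ⁻ Q x∈Q = find (∈-concatMap⁻ varsᵃ {xs = Q} x∈Q)

vars-applyᑫ⁻ : ∀ Q → x ∈ varsᑫ (applyᑫ σ Q) → ∃[ y ] (y ∈ varsᑫ Q × x ∈ varsᵗ (σ y))
vars-applyᑫ⁻ {σ = σ} Q x∈ with ∈-varsᑫ⁻ (applyᑫ σ Q) x∈
... | _ , A′∈ , x∈A′ with ∈-map⁻ (applyᵃ σ) A′∈
... | atom p ts , A∈ , refl =
  let y , y∈ , x∈σy = vars-applyᵗˢ⁻ ts x∈A′ in y , ∈-varsᑫ⁺ A∈ y∈ , x∈σy

vars-subst : ∀ (θ : Subst) {y} → x ∈ varsᵗ (⟦ θ ⟧ y) → x ≡ y ⊎ x ∈Vars θ
vars-subst θ {y} x∈ with ⟦ θ ⟧ y in e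
... | app f ts = inj₂ (y , app≢var ∘ trans (sym e) , inj₂ (subst (_ ∈_) (cong varsᵗ (sym e)) x∈))
  where
  app≢var : app f ts ≢ var y
  app≢var ()
... | var z with here refl ← x∈ with z ≟ y
... | yes z≡y = inj₁ z≡y
... | no  z≢y = inj₂ (y , z≢y ∘ var-injective ∘ trans (sym e)
                        , inj₂ (subst (_ ∈_) (cong varsᵗ (sym e)) x∈))
  where
  var-injective : var z ≡ var y → z ≡ y
  var-injective refl = refl

-- `RenamedApart` speaks only of the initial query and the history. By induction on the derivation,
-- each variable of the current query comes from the initial query, from a clause variant already
-- used or from an earlier mgu, and all three are excluded.
fresh : ∀ {P Q₀ h Q} c → SLD P Q₀ h Q → RenamedApart c Q₀ h →
        x ∈ varsᶜ c → x ∉ varsᑫ Q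
fresh c start apart x∈c = proj₁ (apart _ x∈c)
fresh {x = x} c (step {h} {Q₁} {A} {Q₂} {_} {H} {B} {θ} d _ _ _ _) apart x∈c x∈Q
  with (x∉HB , x∉θ) ∷ _ ← proj₂ (apart x x∈c)
     | x∉earlier ← fresh c d (λ z z∈ → proj₁ (apart z z∈) , All.tail (proj₂ (apart z z∈))) x∈c
  with vars-applyᑫ⁻ (Q₁ ++ B ++ Q₂) x∈Q
... | y , y∈ , x∈θy with vars-subst θ x∈θy
... | inj₂ x∈θ  = x∉θ x∈θ
... | inj₁ refl with ∈-varsᑫ⁻ (Q₁ ++ B ++ Q₂) y∈
... | A′ , A′∈ , x∈A′ with ∈-++⁻ Q₁ A′∈
... | inj₁ A′∈Q₁ = x∉earlier (∈-varsᑫ⁺ (∈-++⁺ˡ A′∈Q₁) x∈A′)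
... | inj₂ A′∈BQ₂ with ∈-++⁻ B A′∈BQ₂
... | inj₁ A′∈B  = x∉HB (∈-++⁺ʳ (varsᵃ H) (∈-varsᑫ⁺ A′∈B x∈A′))
... | inj₂ A′∈Q₂ = x∉earlier (∈-varsᑫ⁺ (∈-++⁺ʳ Q₁ (there A′∈Q₂)) x∈A′)

-- Most generality in `IsMgu` is tested against finitely supported substitutions, so a unifier given
-- as a mere function is first cut down to a finite list.
restrict : List Var → (Var → Term) → Subst
restrict L σ = record { ⟦_⟧ = f ; support = L ; finite = f-finite }
  where
  f : Var → Term
  f x with x ∈? L
  ... | yes _ = σ x
  ... | no  _ = var x
  f-finite : ∀ x → x ∉ L → f x ≡ var x
  f-finite x x∉L with x ∈? L
  ... | yes x∈L = ⊥-elim (x∉L x∈L)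
  ... | no  _   = refl

restrict-∈ : ∀ {L σ} → x ∈ L → ⟦ restrict L σ ⟧ x ≡ σ x
restrict-∈ {x = x} {L} x∈L with x ∈? L
... | yes _   = refl
... | no  x∉L = ⊥-elim (x∉L x∈L)

module _ {D : Set} (π : Var ↔ Var) (L : List Var) (g w : Var → D) where

  -- With `L` the variables of a head renamed by `π`, this joins a valuation `g` of the atom to a
  -- valuation `w` of the head before renaming. It serves both for shapes and for terms.
  glue : Var → D
  glue x with x ∈? L
  ... | yes _ = w (Inverse.from π x)
  ... | no  _ = g x

  glue-∉ : x ∉ L → glue x ≡ g x
  glue-∉ {x = x} x∉L with x ∈? L
  ... | yes x∈L = ⊥-elim (x∉L x∈L)
  ... | no  _   = refl

  glue-∈ : Inverse.to π x ∈ L → glue (Inverse.to π x) ≡ w x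
  glue-∈ {x = x} πx∈L with Inverse.to π x ∈? L
  ... | yes _    = cong w (Inverse.strictlyInverseʳ π x)
  ... | no  πx∉L = ⊥-elim (πx∉L πx∈L)

-- The interpretation by shapes

-- Only arities are kept, so all constants denote the same shape. A variable valued `leaf` therefore
-- agrees with either truth value that it may be bound to.
data Shape : Set where
  node : Vec Shape n → Shape

leaf : Shape
leaf = node []

eval  : (Var → Shape) → Term → Shape
evalˢ : (Var → Shape) → Vec Term n → Vec Shape n
eval v (var x)    = v x
eval v (app f ts) = node (evalˢ v ts)
evalˢ v []       = []
evalˢ v (t ∷ ts) = eval v t ∷ evalˢ v ts

size  : Shape → ℕ
sizes : Vec Shape n → ℕ
size (node ss) = suc (sizes ss)
sizes []       = 0
sizes (s ∷ ss) = size s + sizes ss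

eval-apply  : ∀ v t → eval v (applyᵗ σ t) ≡ eval (eval v ∘ σ) t
evalˢ-apply : ∀ v (ts : Vec Term n) → evalˢ v (applyᵗˢ σ ts) ≡ evalˢ (eval v ∘ σ) ts
eval-apply v (var x)    = refl
eval-apply v (app f ts) = cong node (evalˢ-apply v ts)
evalˢ-apply v []       = refl
evalˢ-apply v (t ∷ ts) = cong₂ _∷_ (eval-apply v t) (evalˢ-apply v ts)

eval-cong  : ∀ {v w} t → (∀ {x} → x ∈ varsᵗ t → v x ≡ w x) → eval v t ≡ eval w t
evalˢ-cong : ∀ {v w} (ts : Vec Term n) → (∀ {x} → x ∈ varsᵗˢ ts → v x ≡ w x) →
             evalˢ v ts ≡ evalˢ w ts
eval-cong (var x)    h = h (here refl)
eval-cong (app f ts) h = cong node (evalˢ-cong ts h)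
evalˢ-cong []       h = refl
evalˢ-cong (t ∷ ts) h =
  cong₂ _∷_ (eval-cong t (h ∘ ∈-++⁺ˡ)) (evalˢ-cong ts (h ∘ ∈-++⁺ʳ (varsᵗ t)))

size-var  : ∀ {v} t → x ∈ varsᵗ t → size (v x) ≤ size (eval v t)
sizes-var : ∀ {v} (ts : Vec Term n) → x ∈ varsᵗˢ ts → size (v x) ≤ sizes (evalˢ v ts)
size-var (var _) (here refl) = ≤-refl
size-var (app f ts) x∈ = <⇒≤ (s≤s (sizes-var ts x∈))
sizes-var (t ∷ ts) x∈ with ∈-++⁻ (varsᵗ t) x∈
... | inj₁ x∈t  = ≤-trans (size-var t x∈t) (m≤m+n _ _)
... | inj₂ x∈ts = ≤-trans (sizes-var ts x∈ts) (m≤n+m _ _)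

-- The value of a proper subterm has strictly smaller size.
occurs⇒≢ : ∀ {v} t → t ≢ var x → x ∈ varsᵗ t → v x ≢ eval v t
occurs⇒≢ (var _) t≢x (here refl) _ = t≢x refl
occurs⇒≢ {x = x} {v} (app f ts) _ x∈ e =
  n≮n (size (v x)) (subst (λ d → size (v x) < size d) (sym e) (s≤s (sizes-var ts x∈)))

-- Symbols of different arities have different types; pairing each with its arity lets a single
-- inequality compare them.
data Clash : Term → Term → Set where
  clash : ∀ {f : Fun m} {g : Fun n} {ss ts} →
          _≢_ {A = ∃ Fun} (m , f) (n , g) → Clash (app f ss) (app g ts)

clash-applyˡ : Clash s t → Clash (applyᵗ σ s) t
clash-applyˡ (clash f≢g) = clash f≢g

clash-applyʳ : Clash s t → Clash s (applyᵗ σ t)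
clash-applyʳ (clash f≢g) = clash f≢g

clash⇒≢ : Clash s t → applyᵗ σ s ≢ applyᵗ τ t
clash⇒≢ (clash f≢g) = f≢g ∘ app-fun
  where
  app-fun : ∀ {f : Fun m} {g : Fun n} {ss ts} → app f ss ≡ app g ts →
            _≡_ {A = ∃ Fun} (m , f) (n , g)
  app-fun refl = refl

-- Compatible equations under the unification steps

Compatible : (Var → Shape) → List Equation → Set
Compatible v E = ∀ {s t} → s ≐ t ∈ E → eval v s ≡ eval v t ⊎ Clash s t

≐*-agree : ∀ {v} {ss ts : Vec Term n} → evalˢ v ss ≡ evalˢ v ts →
           s ≐ t ∈ ss ≐* ts → eval v s ≡ eval v t
≐*-agree {ss = []} {[]} e ()
≐*-agree {ss = _ ∷ _} {_ ∷ _} e (here refl) = ∷-injectiveˡ e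
≐*-agree {ss = _ ∷ _} {_ ∷ _} e (there e∈)  = ≐*-agree (∷-injectiveʳ e) e∈

node-injective : {ss ts : Vec Shape n} → node ss ≡ node ts → ss ≡ ts
node-injective refl = refl

eval-↦ : ∀ {v x t} → v x ≡ eval v t → ∀ s → eval v (applyᵗ [ x ↦ t ] s) ≡ eval v s
eval-↦ {v} {x} {t} e s = trans (eval-apply v s) (eval-cong s (λ {y} _ → at y))
  where
  at : ∀ y → eval v ([ x ↦ t ] y) ≡ v y
  at y with y ≟ x
  ... | yes refl = sym e
  ... | no  _    = refl

-- A clashing equation has two non-variable sides, so only `decompose` could select it, and that
-- needs equal roots; substitution keeps the clash. Other equations stay true: decomposition because
-- `node` is injective, elimination because x and t have the same value.
compatible-⟶ : ∀ {v E E′} → E ⟶ E′ → Compatible v E → Compatible v E′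
compatible-⟶ (decompose {ss = ss} {ts} (E∼ , _)) c {s} {t} e∈ with c (Equivalence.from E∼ (here refl))
... | inj₂ (clash f≢f) = ⊥-elim (f≢f refl)
... | inj₁ e with ∈-++⁻ (ss ≐* ts) e∈
...   | inj₁ e∈ss≐ts = inj₁ (≐*-agree {ss = ss} {ts} (node-injective e) e∈ss≐ts)
...   | inj₂ e∈F     = c (Equivalence.from E∼ (there e∈F))
compatible-⟶ (delete (E∼ , _)) c e∈ = c (Equivalence.from E∼ (there e∈))
compatible-⟶ (swap (E∼ , _) _) c (there e∈) = c (Equivalence.from E∼ (there e∈))
compatible-⟶ (swap (E∼ , _) _) c (here refl) with c (Equivalence.from E∼ (here refl))
... | inj₁ e = inj₁ (sym e)
compatible-⟶ {v} (eliminate {x = x} {t} (E∼ , _) _ _ _) c e∈ with c (Equivalence.from E∼ (here refl))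
... | inj₁ e with e∈
...   | here refl = inj₁ e
...   | there e∈σF with ∈-map⁻ (applyᵉ [ x ↦ t ]) e∈σF
...     | s′ ≐ t′ , e∈F , refl =
  Sum.map (λ eq′ → trans (eval-↦ e s′) (trans eq′ (sym (eval-↦ e t′))))
          (clash-applyˡ ∘ clash-applyʳ)
          (c (Equivalence.from E∼ (there e∈F)))

compatible⇒NSTO : ∀ {v E} → Compatible v E → NSTO E
compatible⇒NSTO c E ε (x , t , e∈ , t≢x , x∈t) with c e∈
... | inj₁ e = occurs⇒≢ t t≢x x∈t e
compatible⇒NSTO c E′ (e ◅ es) = compatible⇒NSTO (compatible-⟶ e c) E′ es

-- Types

data Ty : Set where
  truth value literal : Ty
  list                : Ty → Ty

infixr 5 _∷_
infix  4 _∶_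
infix  6 _⊖_

-- Variables inhabit `value` alone: the skeletons of lists and the signs of literals are fixed, and
-- a binding can only turn a variable into another value.
data _∶_ : Term → Ty → Set where
  isTrue  : trueᵗ ∶ truth
  isFalse : falseᵗ ∶ truth
  isVar   : var x ∶ value
  isTruth : t ∶ truth → t ∶ value
  _⊖_     : s ∶ truth → t ∶ value → s − t ∶ literal
  []      : ∀ {a} → []ᵗ ∶ list a
  _∷_     : ∀ {a} → s ∶ a → t ∶ list a → s ∷ᵗ t ∶ list a

-- The second argument of `eq` is a truth value, so that a call compares a value with a constant and
-- never two variables.
sig : Pred n → Vec Ty n
sig sat-cnf  = list (list literal) ∷ []
sig sat-cl   = list literal ∷ []
sig tflist   = list value ∷ []
sig tf       = value ∷ []
sig eq       = value ∷ truth ∷ []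
sig sat      = list (list literal) ∷ list value ∷ []
sig sat-cl3  = list literal ∷ value ∷ truth ∷ []
sig sat-cl5  = value ∷ truth ∷ value ∷ truth ∷ list literal ∷ []
sig sat-cl5a = value ∷ truth ∷ value ∷ truth ∷ list literal ∷ []

WellTyped : Atom → Set
WellTyped (atom p ts) = Pointwise _∶_ ts (sig p)

apply-∶ : ∀ {a} → t ∶ a → (∀ {x} → x ∈ varsᵗ t → σ x ∶ value) → applyᵗ σ t ∶ a
apply-∶ isTrue    h = isTrue
apply-∶ isFalse   h = isFalse
apply-∶ isVar     h = h (here refl)
apply-∶ (isTruth b) h = isTruth (apply-∶ b h)
apply-∶ {s − t} (b ⊖ v) h =
  apply-∶ b (h ∘ ∈-++⁺ˡ) ⊖ apply-∶ v (h ∘ ∈-++⁺ʳ (varsᵗ s) ∘ ∈-++⁺ˡ)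
apply-∶ [] h = []
apply-∶ {s ∷ᵗ t} (d ∷ e) h =
  apply-∶ d (h ∘ ∈-++⁺ˡ) ∷ apply-∶ e (h ∘ ∈-++⁺ʳ (varsᵗ s) ∘ ∈-++⁺ˡ)

applyˢ-∶ : {ts : Vec Term n} {as : Vec Ty m} → Pointwise _∶_ ts as →
           (∀ {x} → x ∈ varsᵗˢ ts → σ x ∶ value) → Pointwise _∶_ (applyᵗˢ σ ts) as
applyˢ-∶ [] h = []
applyˢ-∶ {ts = t ∷ _} (d ∷ ds) h =
  apply-∶ d (h ∘ ∈-++⁺ˡ) ∷ applyˢ-∶ ds (h ∘ ∈-++⁺ʳ (varsᵗ t))

applyᵃ-WellTyped : ∀ A → WellTyped A → (∀ {x} → x ∈ varsᵃ A → σ x ∶ value) →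
                   WellTyped (applyᵃ σ A)
applyᵃ-WellTyped (atom p ts) = applyˢ-∶

-- Instantiation never removes a root symbol, so a list or a pair cannot become a value. This pulls
-- typing back from an arbitrary unifier to the mgu.
value-instance : ∀ t → applyᵗ σ t ∶ value → t ∶ value
value-instance (var x) _  = isVar
value-instance trueᵗ   _  = isTruth isTrue
value-instance falseᵗ  _  = isTruth isFalse
value-instance []ᵗ      (isTruth ())
value-instance (s ∷ᵗ t) (isTruth ())
value-instance (s − t)  (isTruth ())

truth-leaf : ∀ {v} → t ∶ truth → eval v t ≡ leaf
truth-leaf isTrue  = refl
truth-leaf isFalse = refl

value-leaf : t ∶ value → eval (λ _ → leaf) t ≡ leaf
value-leaf isVar     = refl
value-leaf (isTruth b) = truth-leaf b

-- Properties of the clauses of P₃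

-- Clause variables get no declared types. Inverting the typing of an instance of the head yields
-- the types of their images, which suffice for the body; `σ` will be a renaming followed by an mgu.
BodyWellTyped : Clause → Set
BodyWellTyped (H ← B) = ∀ σ → WellTyped (applyᵃ σ H) → All WellTyped (applyᑫ σ B)

bodyWellTyped : All BodyWellTyped P₃
bodyWellTyped =
    (λ { _ _ → [] })
  ∷ (λ { _ ((c ∷ cs) ∷ []) → (c ∷ []) ∷ (cs ∷ []) ∷ [] })
  ∷ (λ { _ ((p ⊖ v ∷ r) ∷ []) → (r ∷ v ∷ p ∷ []) ∷ [] })
  ∷ (λ { _ _ → [] })
  ∷ (λ { _ (_ ∷ v ∷ p ∷ []) → (v ∷ p ∷ []) ∷ [] })
  ∷ (λ { _ ((p₂ ⊖ v₂ ∷ r) ∷ v₁ ∷ p₁ ∷ []) → (v₁ ∷ p₁ ∷ v₂ ∷ p₂ ∷ r ∷ []) ∷ [] })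
  ∷ (λ { _ (v₁ ∷ p₁ ∷ v₂ ∷ p₂ ∷ r ∷ []) → (v₁ ∷ p₁ ∷ v₂ ∷ p₂ ∷ r ∷ []) ∷ [] })
  ∷ (λ { _ (v₁ ∷ p₁ ∷ v₂ ∷ p₂ ∷ r ∷ []) → (v₂ ∷ p₂ ∷ v₁ ∷ p₁ ∷ r ∷ []) ∷ [] })
  ∷ (λ { _ (v₁ ∷ p₁ ∷ _) → (v₁ ∷ p₁ ∷ []) ∷ [] })
  ∷ (λ { _ (_ ∷ _ ∷ v₂ ∷ p₂ ∷ r ∷ []) → (r ∷ v₂ ∷ p₂ ∷ []) ∷ [] })
  ∷ (λ { _ (cs ∷ vs ∷ []) → (cs ∷ []) ∷ (vs ∷ []) ∷ [] })
  ∷ (λ { _ _ → [] })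
  ∷ (λ { _ ((v ∷ vs) ∷ []) → (vs ∷ []) ∷ (v ∷ []) ∷ [] })
  ∷ (λ { _ _ → [] })
  ∷ (λ { _ _ → [] })
  ∷ []

-- The variables of the arguments `as` of an atom and those of the arguments
-- `ks` of a head are valued separately, since the head is to be renamed apart.
record Solvable (as ks : Vec Term n) : Set where
  field
    shapes   : Var → Shape
    agrees   : Pointwise (λ s t → eval (λ _ → leaf) s ≡ eval shapes t ⊎ Clash s t) as ks
    constant : applyᵗˢ σ as ≡ applyᵗˢ τ ks →
               ∃[ b ] ∃[ κ ] (b ∶ truth × applyᵗˢ (λ _ → b) as ≡ applyᵗˢ κ ks)

-- Here the atom is an instance of the head by `κ`, except in arguments that clash. The head
-- variables are valued through `κ`, and any truth value can be substituted for the variables of the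
-- atom. Clashing arguments contradict the unifiability assumed in `constant`.
match⇒Solvable : {as ks : Vec Term n} (κ : Var → Term) →
                 Pointwise (λ s t → s ≡ applyᵗ κ t ⊎ Clash s t) as ks → Solvable as ks
match⇒Solvable κ match = record
  { shapes   = eval (λ _ → leaf) ∘ κ
  ; agrees   = Pointwise.map (λ {_} {t} → Sum.map₁ λ { refl → eval-apply _ t }) match
  ; constant = λ e → trueᵗ , (applyᵗ (λ _ → trueᵗ) ∘ κ) , isTrue , instances match e
  }
  where
  instances : {as ks : Vec Term n} →
              Pointwise (λ s t → s ≡ applyᵗ κ t ⊎ Clash s t) as ks →
              applyᵗˢ σ as ≡ applyᵗˢ τ ks →
              applyᵗˢ (λ _ → trueᵗ) as ≡ applyᵗˢ (applyᵗ (λ _ → trueᵗ) ∘ κ) ks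
  instances [] _ = refl
  instances (inj₂ c ∷ _) e = ⊥-elim (clash⇒≢ c (∷-injectiveˡ e))
  instances (_∷_ {y = t} (inj₁ refl) match) e =
    cong₂ _∷_ (applyᵗ-∘ t) (instances match (∷-injectiveʳ e))

HeadSolvable : Clause → Set
HeadSolvable (atom p ks ← _) = ∀ {as} → Pointwise _∶_ as (sig p) → Solvable as ks

infixr 5 _⇒_∥_

_⇒_∥_ : Var → Term → (Var → Term) → Var → Term
(x ⇒ t ∥ κ) y with x ≟ y
... | yes _ = t
... | no  _ = κ y

-- Typing makes a list argument either empty or a cons, so it matches the head or clashes with it.
-- The numerals are the clause variables as coded in `P₃`. Only `eq` and `tf` can bind variables of
-- the atom and are treated apart.
headSolvable : All HeadSolvable P₃
headSolvable =
    (λ { ([] ∷ [])       → match⇒Solvable var (inj₁ refl ∷ [])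
       ; ((_ ∷ _) ∷ [])  → match⇒Solvable var (inj₂ (clash (λ ())) ∷ []) })
  ∷ (λ { ([] ∷ [])       → match⇒Solvable var (inj₂ (clash (λ ())) ∷ [])
       ; {(c ∷ᵗ cs) ∷ []} ((_ ∷ _) ∷ [])  →
           match⇒Solvable (0 ⇒ c ∥ 1 ⇒ cs ∥ var) (inj₁ refl ∷ []) })
  ∷ (λ { ([] ∷ [])       → match⇒Solvable var (inj₂ (clash (λ ())) ∷ [])
       ; {(p − v ∷ᵗ r) ∷ []} ((_ ⊖ _ ∷ _) ∷ []) →
           match⇒Solvable (2 ⇒ p ∥ 3 ⇒ v ∥ 4 ⇒ r ∥ var) (inj₁ refl ∷ []) })
  ∷ eq-solvable
  ∷ (λ { {_ ∷ v ∷ p ∷ []} ([] ∷ _ ∷ _ ∷ []) →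
           match⇒Solvable (3 ⇒ v ∥ 2 ⇒ p ∥ var) (inj₁ refl ∷ inj₁ refl ∷ inj₁ refl ∷ [])
       ; {_ ∷ v ∷ p ∷ []} ((_ ∷ _) ∷ _ ∷ _ ∷ []) →
           match⇒Solvable (3 ⇒ v ∥ 2 ⇒ p ∥ var)
             (inj₂ (clash (λ ())) ∷ inj₁ refl ∷ inj₁ refl ∷ []) })
  ∷ (λ { {_ ∷ v ∷ p ∷ []} ([] ∷ _ ∷ _ ∷ []) →
           match⇒Solvable (7 ⇒ v ∥ 6 ⇒ p ∥ var)
             (inj₂ (clash (λ ())) ∷ inj₁ refl ∷ inj₁ refl ∷ [])
       ; {(p₂ − v₂ ∷ᵗ r) ∷ v₁ ∷ p₁ ∷ []} ((_ ⊖ _ ∷ _) ∷ _ ∷ _ ∷ []) →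
           match⇒Solvable (8 ⇒ p₂ ∥ 9 ⇒ v₂ ∥ 4 ⇒ r ∥ 7 ⇒ v₁ ∥ 6 ⇒ p₁ ∥ var)
             (inj₁ refl ∷ inj₁ refl ∷ inj₁ refl ∷ []) })
  ∷ (λ _ → sat-cl5-solvable)
  ∷ (λ _ → sat-cl5-solvable)
  ∷ (λ _ → sat-cl5-solvable)
  ∷ (λ _ → sat-cl5-solvable)
  ∷ (λ { {cs ∷ vs ∷ []} _ →
           match⇒Solvable (1 ⇒ cs ∥ 10 ⇒ vs ∥ var) (inj₁ refl ∷ inj₁ refl ∷ []) })
  ∷ (λ { ([] ∷ [])       → match⇒Solvable var (inj₁ refl ∷ [])
       ; ((_ ∷ _) ∷ [])  → match⇒Solvable var (inj₂ (clash (λ ())) ∷ []) })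
  ∷ (λ { ([] ∷ [])       → match⇒Solvable var (inj₂ (clash (λ ())) ∷ [])
       ; {(v ∷ᵗ vs) ∷ []} ((_ ∷ _) ∷ [])  →
           match⇒Solvable (3 ⇒ v ∥ 10 ⇒ vs ∥ var) (inj₁ refl ∷ []) })
  ∷ tf-solvable isTrue
  ∷ tf-solvable isFalse
  ∷ []
  where
  sat-cl5-solvable : {as : Vec Term 5} →
                     Solvable as (var 7 ∷ var 6 ∷ var 9 ∷ var 8 ∷ var 4 ∷ [])
  sat-cl5-solvable {v₁ ∷ p₁ ∷ v₂ ∷ p₂ ∷ r ∷ []} =
    match⇒Solvable (7 ⇒ v₁ ∥ 6 ⇒ p₁ ∥ 9 ⇒ v₂ ∥ 8 ⇒ p₂ ∥ 4 ⇒ r ∥ var)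
      (inj₁ refl ∷ inj₁ refl ∷ inj₁ refl ∷ inj₁ refl ∷ inj₁ refl ∷ [])

  -- The repeated head variable rules out matching. Both arguments denote `leaf`, and the second
  -- one, a ground truth value, is itself the constant to substitute.
  eq-solvable : {as : Vec Term 2} → Pointwise _∶_ as (value ∷ truth ∷ []) →
                Solvable as (var 5 ∷ var 5 ∷ [])
  eq-solvable {s ∷ t ∷ []} (v ∷ b ∷ []) = record
    { shapes   = λ _ → leaf
    ; agrees   = inj₁ (value-leaf v) ∷ inj₁ (truth-leaf b) ∷ []
    ; constant = λ e → t , (λ _ → t) , b ,
        cong₂ (λ s′ t′ → s′ ∷ t′ ∷ [])
          -- Any unifier sends both arguments to its value at the head variable; if the first is
          -- ground as well, it must then be the same truth value.
          (unified v b (trans (∷-injectiveˡ e) (sym (∷-injectiveˡ (∷-injectiveʳ e)))))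
          (closed b)
    }
    where
    closed : t ∶ truth → applyᵗ σ t ≡ t
    closed isTrue  = refl
    closed isFalse = refl

    unified : s ∶ value → t ∶ truth → applyᵗ σ s ≡ applyᵗ σ t → applyᵗ (λ _ → t) s ≡ t
    unified isVar             _       _  = refl
    unified (isTruth isTrue)  isTrue  _  = refl
    unified (isTruth isFalse) isFalse _  = refl
    unified (isTruth isTrue)  isFalse ()
    unified (isTruth isFalse) isTrue  ()

  -- A variable argument gets bound by the head, so the substituted constant has to be the one in
  -- the head. Against the opposite truth value the shapes still agree, while `constant` holds
  -- vacuously.
  tf-solvable : ∀ {b} → b ∶ truth → {as : Vec Term 1} →
                Pointwise _∶_ as (value ∷ []) → Solvable as (b ∷ [])
  tf-solvable {b} d {s ∷ []} (v ∷ []) = record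
    { shapes   = λ _ → leaf
    ; agrees   = inj₁ (trans (value-leaf v) (sym (truth-leaf d))) ∷ []
    ; constant = λ e → b , var , d , unified d v e
    }
    where
    unified : ∀ {b s} → b ∶ truth → s ∶ value →
              applyᵗˢ σ (s ∷ []) ≡ applyᵗˢ τ (b ∷ []) →
              applyᵗˢ (λ _ → b) (s ∷ []) ≡ applyᵗˢ var (b ∷ [])
    unified isTrue  isVar             _  = refl
    unified isFalse isVar             _  = refl
    unified isTrue  (isTruth isTrue)  _  = refl
    unified isFalse (isTruth isFalse) _  = refl
    unified isTrue  (isTruth isFalse) ()
    unified isFalse (isTruth isTrue)  ()

-- Renaming the head apart

atom-pred : ∀ {p : Pred m} {q : Pred n} {ss ts} → atom p ss ≡ atom q ts →
            _≡_ {A = ∃ Pred} (m , p) (n , q)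
atom-pred refl = refl

atom-injective : ∀ {p : Pred n} {ss ts} → atom p ss ≡ atom p ts → ss ≡ ts
atom-injective refl = refl

module _ {as ks : Vec Term n}
         (ρ : Subst) (π : Var ↔ Var) (ρ≗π : ∀ x → ⟦ ρ ⟧ x ≡ var (Inverse.to π x))
         (apart : ∀ {x} → x ∈ varsᵗˢ as → x ∉ varsᵗˢ (applyᵗˢ ⟦ ρ ⟧ ks))
         (solvable : Solvable as ks) where

  private
    hs : Vec Term n
    hs = applyᵗˢ ⟦ ρ ⟧ ks

    open Solvable solvable

    image : x ∈ varsᵗˢ ks → Inverse.to π x ∈ varsᵗˢ hs
    image {x} x∈ =
      vars-applyᵗˢ⁺ ks x∈ (subst (λ r → Inverse.to π x ∈ varsᵗ r) (sym (ρ≗π x)) (here refl))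

  -- Because the head is renamed apart, one valuation can be `leaf` on the atom and follow `shapes`,
  -- transported along the renaming, on the head.
  solvable⇒NSTO : NSTO (as ≐* hs)
  solvable⇒NSTO = compatible⇒NSTO
    (transfer agrees (glue-∉ π _ _ shapes ∘ apart)
      (λ {x} x∈ → trans (cong (eval v) (ρ≗π x)) (glue-∈ π _ _ shapes (image x∈))))
    where
    v : Var → Shape
    v = glue π (varsᵗˢ hs) (λ _ → leaf) shapes

    transfer : {as ks : Vec Term m} →
      Pointwise (λ s t → eval (λ _ → leaf) s ≡ eval shapes t ⊎ Clash s t) as ks →
      (∀ {x} → x ∈ varsᵗˢ as → v x ≡ leaf) →
      (∀ {x} → x ∈ varsᵗˢ ks → eval v (⟦ ρ ⟧ x) ≡ shapes x) →
      Compatible v (as ≐* applyᵗˢ ⟦ ρ ⟧ ks)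
    transfer (_∷_ {x = s} {y = t} d _) f g (here refl) =
      Sum.map (λ e → trans (eval-cong s (f ∘ ∈-++⁺ˡ))
                 (trans e (trans (eval-cong t (sym ∘ g ∘ ∈-++⁺ˡ)) (sym (eval-apply v t)))))
              clash-applyʳ d
    transfer (_∷_ {x = s} {y = t} _ ds) f g (there e∈) =
      transfer ds (f ∘ ∈-++⁺ʳ (varsᵗ s)) (g ∘ ∈-++⁺ʳ (varsᵗ t)) e∈

  -- The unifier `υ` factors through `θ`, so its value at `x` is an instance of `⟦ θ ⟧ x`. That
  -- value is the truth value `b` if `x` occurs in the atom, and `x` itself otherwise. The second
  -- case matters for the other atoms of the query, as `θ` may move variables foreign to the
  -- equation.
  mgu-value : ∀ {p : Pred n} θ → IsMgu θ (atom p as) (atom p hs) → x ∉ varsᵗˢ hs → ⟦ θ ⟧ x ∶ value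
  mgu-value {x} {p} θ (unifies , mostGeneral) x∉
    with b , κ , b∶truth , e ← constant (trans (atom-injective unifies) (applyᵗˢ-∘ ks)) =
    let η , υ≗ηθ = mostGeneral υ (cong (atom p) υ-unifies)
    in value-instance (⟦ θ ⟧ x) (subst (_∶ value) (υ≗ηθ x) υx∶value)
    where
    u : Var → Term
    u = glue π (varsᵗˢ hs) (λ _ → b) κ

    υ : Subst
    υ = restrict (varsᵗˢ as ++ varsᵗˢ hs) u

    υ-∈hs : ∀ {y} → y ∈ varsᵗˢ hs → ⟦ υ ⟧ y ≡ u y
    υ-∈hs y∈ = restrict-∈ (∈-++⁺ʳ (varsᵗˢ as) y∈)

    υ-unifies : applyᵗˢ ⟦ υ ⟧ as ≡ applyᵗˢ ⟦ υ ⟧ hs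
    υ-unifies =
      -- On the atom `υ` is constantly `b`; on the renamed head it undoes the renaming and applies
      -- `κ`. What remains is `e`.
      trans (applyᵗˢ-cong as (λ y∈ → trans (restrict-∈ (∈-++⁺ˡ y∈)) (glue-∉ π _ _ κ (apart y∈))))
        (trans e (trans
          (applyᵗˢ-cong ks (λ {y} y∈ → sym (trans (cong (applyᵗ ⟦ υ ⟧) (ρ≗π y))
            (trans (υ-∈hs (image y∈)) (glue-∈ π _ _ κ (image y∈))))))
          (sym (applyᵗˢ-∘ ks))))

    υx∶value : ⟦ υ ⟧ x ∶ value
    υx∶value with x ∈? varsᵗˢ as ++ varsᵗˢ hs
    ... | yes _ = subst (_∶ value) (sym (glue-∉ π _ _ κ x∉)) (isTruth b∶truth)
    ... | no  _ = isVar

-- Derivations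

-- The remaining atoms keep their types since their variables avoid the clause, and `mgu-value`
-- applies to them. The new atoms are typed because the instance of the head equals that of the
-- selected atom.
wellTyped : ∀ {Q₀ h Q} → All WellTyped Q₀ → SLD P₃ Q₀ h Q → All WellTyped Q
wellTyped Q₀-typed start = Q₀-typed
wellTyped Q₀-typed
  (step {Q₁ = Q₁} {A@(atom p as)} {Q₂} {atom q ks ← B} {θ = θ}
    d c∈ (ρ , (π , ρ≗π) , refl) apart mgu)
  -- Unifiability forces equal predicates, so the atom and the head share a signature.
  with refl ← atom-pred {p = p} {q} (proj₁ mgu)
  with Q₁-typed , A-typed ∷ Q₂-typed ← All.++⁻ Q₁ (wellTyped Q₀-typed d) =
  All.map⁺ (All.++⁺ (instances Q₁-typed (∈-++⁺ˡ {xs = Q₁}))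
    (All.++⁺ (All.map⁻ body) (instances Q₂-typed (∈-++⁺ʳ Q₁ ∘ there))))
  where
  disjoint : ∀ {A′ x} → A′ ∈ Q₁ ++ A ∷ Q₂ → x ∈ varsᵃ A′ → x ∉ varsᵗˢ (applyᵗˢ ⟦ ρ ⟧ ks)
  disjoint A′∈ x∈ x∈hs =
    fresh (applyᶜ ⟦ ρ ⟧ (atom p ks ← B)) d apart (∈-++⁺ˡ x∈hs) (∈-varsᑫ⁺ A′∈ x∈)

  θ-value : ∀ {A′ x} → A′ ∈ Q₁ ++ A ∷ Q₂ → x ∈ varsᵃ A′ → ⟦ θ ⟧ x ∶ value
  θ-value A′∈ x∈ = mgu-value ρ π ρ≗π (disjoint (∈-++⁺ʳ Q₁ (here refl)))
    (All.lookup headSolvable c∈ A-typed) θ mgu (disjoint A′∈ x∈)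

  instances : ∀ {Q} → All WellTyped Q → (∀ {A′} → A′ ∈ Q → A′ ∈ Q₁ ++ A ∷ Q₂) →
              All (WellTyped ∘ applyᵃ ⟦ θ ⟧) Q
  instances typed ⊆ = All.tabulate λ {A′} A′∈ →
    applyᵃ-WellTyped A′ (All.lookup typed A′∈) (θ-value (⊆ A′∈))

  head : WellTyped (applyᵃ (applyᵗ ⟦ θ ⟧ ∘ ⟦ ρ ⟧) (atom p ks))
  head = subst WellTyped (trans (proj₁ mgu) (applyᵃ-∘ (atom p ks)))
    (applyᵃ-WellTyped A A-typed (θ-value (∈-++⁺ʳ Q₁ (here refl))))

  body : All WellTyped (applyᑫ ⟦ θ ⟧ (applyᑫ ⟦ ρ ⟧ B))
  body = subst (All WellTyped) (sym (applyᑫ-∘ B)) (All.lookup bodyWellTyped c∈ _ head)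

wellTyped⇒OccurCheckUnnecessary : ∀ {Q₀} → All WellTyped Q₀ → OccurCheckUnnecessary P₃ Q₀
wellTyped⇒OccurCheckUnnecessary Q₀-typed d A∈ {c = c@(atom _ _ ← _)} c∈ (ρ , (π , ρ≗π) , refl) apart =
  solvable⇒NSTO ρ π ρ≗π
    (λ x∈ x∈hs → fresh (applyᶜ ⟦ ρ ⟧ c) d apart (∈-++⁺ˡ x∈hs) (∈-varsᑫ⁺ A∈ x∈))
    (All.lookup headSolvable c∈ (All.lookup (wellTyped Q₀-typed d) A∈))

-- Typing of the initial query

listᵗ-∶ : ∀ {A : Set} {f : A → Term} {a} → (∀ x → f x ∶ a) → ∀ xs → listᵗ (map f xs) ∶ list a
listᵗ-∶ h []       = []
listᵗ-∶ h (x ∷ xs) = h x ∷ listᵗ-∶ h xs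

repLiteral-∶ : ∀ ν l → repLiteral ν l ∶ literal
repLiteral-∶ ν (pos x) = isTrue ⊖ isVar
repLiteral-∶ ν (neg x) = isFalse ⊖ isVar

mainTheorem5 : (ν : PropVar → Var) → Injective _≡_ _≡_ ν →
    (φ : CNF) (xs : List Var) → IsListOfVars xs (repCNF ν φ) →
    OccurCheckUnnecessary P₃ (atom sat (repCNF ν φ ∷ listᵗ (map var xs) ∷ []) ∷ [])
mainTheorem5 ν _ φ xs _ = wellTyped⇒OccurCheckUnnecessary
  ((listᵗ-∶ (listᵗ-∶ (repLiteral-∶ ν)) φ ∷ listᵗ-∶ (λ _ → isVar) xs ∷ []) ∷ [])
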